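{- Let $\mathcal T$ be a subsequential, complete transducer whose underlying graph is weakly connected. Then the following two assertions are equivalent: (d) There exists a constant $k\in\mathbb R$ such that the random variable $\mathsf{Output}(X_n)$ is quasi-deterministic with value $kn+\mathcal O(1)$. (e) There exists a constant $k\in\mathbb R$ such that $\delta(C)=k\,\mathds 1(C)$ holds for every directed cycle $C$ of the transducer.
   Context: A transducer consists of a finite set of states $\{1,\dots,S\}$, a finite input alphabet $\mathcal A_I\subseteq\mathbb R$ (with at least two elements), an output alphabet $\mathcal A_O\subseteq\mathbb R$, a set of transitions $\mathcal E\subseteq\{1,\dots,S\}^2\times\mathcal A_I$, output labels $\delta\colon\mathcal E\to\mathcal A_O$, and the initial state $1$. A transition $e=(s,t,\varepsilon)$ goes from $s$ to $t$ and has input label $\varepsilon$ and output label $\delta(e)$. The underlying graph is the directed multigraph (loops and parallel edges allowed) whose vertices are the states and whose edges are the transitions. The transducer is deterministic if for every state $s$ and $\varepsilon\in\mathcal A_I$ there is at most one $t$ with $(s,t,\varepsilon)\in\mathcal E$; complete if for every $s$ and $\varepsilon$ there is some such $t$; subsequential if it is deterministic, every state is final, and it has a final output $a\colon\{1,\dots,S\}\to\mathcal A_O$. The output of the transducer on an input word is the sequence of output labels along the unique path starting at state $1$ whose input labels are the word (read in a fixed direction, from right to left), together with the final output label of the last state of this path. $X_n$ is a uniformly distributed random word in $\mathcal A_I^n$ and $\mathsf{Output}(X_n)$ is the sum of the output sequence of the transducer if the input is $X_n$. The output sum is called quasi-deterministic (with value $kn+\mathcal O(1)$) if there is a constant $k\in\mathbb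 R$ such that $\mathsf{Output}(X_n)=kn+\mathcal O(1)$ holds for all $n$ and all inputs, i.e. the difference between the output sum and $kn$ is bounded uniformly over all $n$ and all input words in $\mathcal A_I^n$. A cycle is a strongly connected digraph in which every vertex has out-degree $1$ (a loop is a cycle of length $1$); a directed cycle of the transducer is a cycle in its underlying graph. For a function $g$ on transitions and a cycle $C$, $g(C)=\sum_{e\in C}g(e)$; $\mathds 1$ is the constant function $1$, so $\mathds 1(C)$ is the length of $C$, and $\delta(C)$ is the sum of the output labels of the transitions of $C$.
   Formalization: The formal theorem additionally assumes that every state is reachable from the initial state 1; with weak connectivity alone (d) does not imply (e), since a cycle unreachable from state 1 never affects the output. -}

module Defs where

open import Algebra.Bundles.Raw using (RawMonoid)
open import Data.Fin.Base using (Fin; zero)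
open import Data.Fin.Subset using (Subset; _∈_; Nonempty)
open import Data.Fin.Subset.Properties using (_∈?_)
open import Data.List.Base using (List; []; _∷_; foldr)
open import Data.Nat.Base as ℕ using (ℕ; suc)
import Data.Nat.Properties as ℕ
open import Data.Product using (∃; ∃!; ∃-syntax; _×_; _,_; proj₁; proj₂)
open import Data.Rational.Base as ℚ using (ℚ; 0ℚ; ½)
import Data.Rational.Properties as ℚ
import Data.Rational.Solver as ℚ-Solver
open import Data.Bool.Base using (if_then_else_)
open import Data.Sum.Base using (inj₁; inj₂)
open import Data.Vec.Base using (Vec; []; _∷_)
open import Function.Definitions using (Injective)
open import Level using (0ℓ)
open import Relation.Binary.Construct.Closure.Equivalence using (EqClosure)
open import Relation.Binary.Construct.Closure.ReflexiveTransitive using (Star)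
open import Relation.Binary.Core using (Rel)
open import Relation.Binary.Definitions using (_Respects_)
open import Relation.Binary.PropositionalEquality
open import Relation.Nullary.Decidable.Core using (does)
open import Relation.Unary using (Pred)
import Algebra.Definitions.RawMonoid as Multiple

------------------------------------------------------------------------
-- Real numbers: Cauchy sequences of rationals (with a modulus), compared
-- by the relation _≃_ that identifies sequences whose difference is null.

IsCauchy : (ℕ → ℚ) → Set
IsCauchy x = ∀ ε → 0ℚ ℚ.< ε →
  ∃[ N ] ∀ m n → N ℕ.≤ m → N ℕ.≤ n → ℚ.∣ x m ℚ.- x n ∣ ℚ.< ε

record ℝ : Set where
  constructor mkℝ
  field
    seq    : ℕ → ℚ
    cauchy : IsCauchy seq

open ℝ public

infix 4 _≃_ _≤ᴿ_

_≃_ : Rel ℝ 0ℓ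
x ≃ y = ∀ ε → 0ℚ ℚ.< ε → ∃[ N ] ∀ n → N ℕ.≤ n → ℚ.∣ seq x n ℚ.- seq y n ∣ ℚ.< ε

_≤ᴿ_ : Rel ℝ 0ℓ
x ≤ᴿ y = ∀ ε → 0ℚ ℚ.< ε → ∃[ N ] ∀ n → N ℕ.≤ n → seq x n ℚ.< seq y n ℚ.+ ε

private
  half-pos : ∀ ε → 0ℚ ℚ.< ε → 0ℚ ℚ.< ε ℚ.* ½
  half-pos ε 0<ε = ℚ.*-monoˡ-<-pos ½ 0<ε

  half+half : ∀ ε → ε ℚ.* ½ ℚ.+ ε ℚ.* ½ ≡ ε
  half+half ε = trans (sym (ℚ.*-distribˡ-+ ε ½ ½)) (ℚ.*-identityʳ ε)

  ∣-∣-comm : ∀ p q → ℚ.∣ p ℚ.- q ∣ ≡ ℚ.∣ q ℚ.- p ∣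
  ∣-∣-comm p q = trans (sym (ℚ.∣-p∣≡∣p∣ (p ℚ.- q))) (cong ℚ.∣_∣
    (solve 2 (λ a b → :- (a :+ :- b) := b :+ :- a) refl p q))
    where open ℚ-Solver.+-*-Solver

  ∣p∣-∣q∣≤∣p-q∣ : ∀ p q → ℚ.∣ p ∣ ℚ.- ℚ.∣ q ∣ ℚ.≤ ℚ.∣ p ℚ.- q ∣
  ∣p∣-∣q∣≤∣p-q∣ p q = begin
    ℚ.∣ p ∣ ℚ.- ℚ.∣ q ∣
      ≡⟨ cong (λ r → ℚ.∣ r ∣ ℚ.- ℚ.∣ q ∣)
              (solve 2 (λ a b → a := (a :+ :- b) :+ b) refl p q) ⟩
    ℚ.∣ p ℚ.- q ℚ.+ q ∣ ℚ.- ℚ.∣ q ∣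
      ≤⟨ ℚ.+-monoˡ-≤ (ℚ.- ℚ.∣ q ∣) (ℚ.∣p+q∣≤∣p∣+∣q∣ (p ℚ.- q) q) ⟩
    ℚ.∣ p ℚ.- q ∣ ℚ.+ ℚ.∣ q ∣ ℚ.- ℚ.∣ q ∣
      ≡⟨ solve 2 (λ a b → (a :+ b) :+ :- b := a) refl ℚ.∣ p ℚ.- q ∣ ℚ.∣ q ∣ ⟩
    ℚ.∣ p ℚ.- q ∣ ∎
    where
    open ℚ.≤-Reasoning
    open ℚ-Solver.+-*-Solver

  reverse-triangle : ∀ p q → ℚ.∣ ℚ.∣ p ∣ ℚ.- ℚ.∣ q ∣ ∣ ℚ.≤ ℚ.∣ p ℚ.- q ∣
  reverse-triangle p q with ℚ.∣p∣≡p∨∣p∣≡-p (ℚ.∣ p ∣ ℚ.- ℚ.∣ q ∣)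
  ... | inj₁ eq = subst (ℚ._≤ ℚ.∣ p ℚ.- q ∣) (sym eq) (∣p∣-∣q∣≤∣p-q∣ p q)
  ... | inj₂ eq = subst₂ ℚ._≤_
    (sym (trans eq (solve 2 (λ a b → :- (a :+ :- b) := b :+ :- a) refl ℚ.∣ p ∣ ℚ.∣ q ∣)))
    (∣-∣-comm q p) (∣p∣-∣q∣≤∣p-q∣ q p)
    where open ℚ-Solver.+-*-Solver

0ᴿ : ℝ
0ᴿ = mkℝ (λ _ → 0ℚ) (λ _ 0<ε → 0 , λ _ _ _ _ → 0<ε)

infixl 6 _+ᴿ_ _-ᴿ_
infix  8 -ᴿ_

_+ᴿ_ : ℝ → ℝ → ℝ
mkℝ x cx +ᴿ mkℝ y cy = mkℝ (λ n → x n ℚ.+ y n) isCauchy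
  where
  isCauchy : IsCauchy (λ n → x n ℚ.+ y n)
  isCauchy ε 0<ε with cx (ε ℚ.* ½) (half-pos ε 0<ε) | cy (ε ℚ.* ½) (half-pos ε 0<ε)
  ... | M , x-close | N , y-close = M ℕ.⊔ N , λ m n M⊔N≤m M⊔N≤n → begin-strict
    ℚ.∣ x m ℚ.+ y m ℚ.- (x n ℚ.+ y n) ∣
      ≡⟨ cong ℚ.∣_∣ (solve 4 (λ a b c d →
           (a :+ b) :+ :- (c :+ d) := (a :+ :- c) :+ (b :+ :- d)) refl
           (x m) (y m) (x n) (y n)) ⟩
    ℚ.∣ (x m ℚ.- x n) ℚ.+ (y m ℚ.- y n) ∣
      ≤⟨ ℚ.∣p+q∣≤∣p∣+∣q∣ (x m ℚ.- x n) (y m ℚ.- y n) ⟩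
    ℚ.∣ x m ℚ.- x n ∣ ℚ.+ ℚ.∣ y m ℚ.- y n ∣
      <⟨ ℚ.+-mono-<
           (x-close m n (ℕ.m⊔n≤o⇒m≤o M N M⊔N≤m) (ℕ.m⊔n≤o⇒m≤o M N M⊔N≤n))
           (y-close m n (ℕ.m⊔n≤o⇒n≤o M N M⊔N≤m) (ℕ.m⊔n≤o⇒n≤o M N M⊔N≤n)) ⟩
    ε ℚ.* ½ ℚ.+ ε ℚ.* ½
      ≡⟨ half+half ε ⟩
    ε ∎
    where
    open ℚ.≤-Reasoning
    open ℚ-Solver.+-*-Solver

-ᴿ_ : ℝ → ℝ
-ᴿ mkℝ x cx = mkℝ (λ n → ℚ.- x n) λ ε 0<ε →
  let N , close = cx ε 0<ε in N , λ m n N≤m N≤n →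
    subst (ℚ._< ε) (cong ℚ.∣_∣ (solve 2 (λ a b → a :+ :- b := :- b :+ :- (:- a)) refl (x n) (x m)))
      (close n m N≤n N≤m)
  where open ℚ-Solver.+-*-Solver

_-ᴿ_ : ℝ → ℝ → ℝ
x -ᴿ y = x +ᴿ (-ᴿ y)

∣_∣ᴿ : ℝ → ℝ
∣ mkℝ x cx ∣ᴿ = mkℝ (λ n → ℚ.∣ x n ∣) λ ε 0<ε →
  let N , close = cx ε 0<ε in N , λ m n N≤m N≤n →
    ℚ.≤-<-trans (reverse-triangle (x m) (x n)) (close m n N≤m N≤n)

ℝ-+-rawMonoid : RawMonoid 0ℓ 0ℓ
ℝ-+-rawMonoid = record { Carrier = ℝ ; _≈_ = _≃_ ; _∙_ = _+ᴿ_ ; ε = 0ᴿ }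

-- n · x = x + ⋯ + x with n summands
infixr 8 _·_

_·_ : ℕ → ℝ → ℝ
_·_ = Multiple._×_ ℝ-+-rawMonoid

------------------------------------------------------------------------
-- Transducers

record Transducer : Set₁ where
  field
    -- The states 1, …, S are Fin S with S = suc S-1; state 1 is zero.
    S-1 : ℕ

  State : Set
  State = Fin (suc S-1)

  initial : State
  initial = zero

  field
    -- A finite subset of ℝ is given by an injective enumeration.
    ∣A-I∣     : ℕ
    2≤∣A-I∣   : 2 ℕ.≤ ∣A-I∣
    A-I       : Fin ∣A-I∣ → ℝ
    A-I-inj   : Injective _≡_ _≃_ A-I
    A-O       : Pred ℝ 0ℓ
    A-O-resp  : A-O Respects _≃_

  -- An element of the input alphabet, named by its index.
  Letter : Set
  Letter = Fin ∣A-I∣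

  field
    -- The set of transitions, a finite subset of State × State × Letter,
    -- is likewise given by an injective enumeration.
    ∣E∣   : ℕ
    E     : Fin ∣E∣ → State × State × Letter
    E-inj : Injective _≡_ _≡_ E

  Transition : Set
  Transition = Fin ∣E∣

  field
    δ : Transition → ∃ A-O

  infix 4 _∈E

  _∈E : State × State × Letter → Set
  p ∈E = ∃[ e ] E e ≡ p

  source target : Transition → State
  source e = proj₁ (E e)
  target e = proj₁ (proj₂ (E e))

module _ (T : Transducer) where
  open Transducer T

  Deterministic : Set
  Deterministic = ∀ s ε {t t′} → (s , t , ε) ∈E → (s , t′ , ε) ∈E → t ≡ t′

  Complete : Set
  Complete = ∀ s ε → ∃[ t ] (s , t , ε) ∈E

  -- Every state is final, since finalOutput is total.
  record Subsequential : Set where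
    field
      deterministic : Deterministic
      finalOutput   : State → ∃ A-O

  Edge : Rel State 0ℓ
  Edge s t = ∃[ e ] source e ≡ s × target e ≡ t

  WeaklyConnected : Set
  WeaklyConnected = ∀ s t → EqClosure Edge s t

  Accessible : Set
  Accessible = ∀ s → Star Edge initial s

  ----------------------------------------------------------------------
  -- Output

  -- Run w t: a path from the initial state to t with input labels w.
  -- Words are read from right to left, so the head of w is read last.
  data Run : ∀ {n} → Vec Letter n → State → Set where
    []  : Run [] initial
    _▷_ : ∀ {n ε s t} {w : Vec Letter n} →
          Run w s → (s , t , ε) ∈E → Run (ε ∷ w) t

  -- Written from right to left, as the input is read.
  outputLabels : ∀ {n t} {w : Vec Letter n} → Run w t → List (∃ A-O)
  outputLabels []            = []
  outputLabels (r ▷ (e , _)) = δ e ∷ outputLabels r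

  run : Complete → ∀ {n} (w : Vec Letter n) → ∃[ t ] Run w t
  run complete []      = initial , []
  run complete (ε ∷ w) =
    let s , r    = run complete w
        t , st∈E = complete s ε
    in  t , r ▷ st∈E

  E-irrelevant : ∀ {p} (q q′ : p ∈E) → q ≡ q′
  E-irrelevant (e , refl) (e′ , eq) with refl ← E-inj eq with refl ← eq = refl

  run-unique : Deterministic → ∀ {n} {w : Vec Letter n} (p q : ∃[ t ] Run w t) → p ≡ q
  run-unique det (_ , [])     (_ , [])       = refl
  run-unique det (_ , r ▷ st) (_ , r′ ▷ st′)
    with refl ← run-unique det (_ , r) (_ , r′)
    with refl ← det _ _ st st′
    with refl ← E-irrelevant st st′ = refl

  module _ (subsequential : Subsequential) (complete : Complete) where
    open Subsequential subsequential

    outputSequence : ∀ {n} → Vec Letter n → List (∃ A-O)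
    outputSequence w = let t , r = run complete w in finalOutput t ∷ outputLabels r

    Output : ∀ {n} → Vec Letter n → ℝ
    Output w = foldr (λ y s → proj₁ y +ᴿ s) 0ᴿ (outputSequence w)

    QuasiDeterministic : ℝ → Set
    QuasiDeterministic k =
      ∃[ B ] ∀ n (w : Vec Letter n) → ∣ Output w -ᴿ n · k ∣ᴿ ≤ᴿ B

  ----------------------------------------------------------------------
  -- Directed cycles

  record Subgraph : Set where
    field
      vertices : Subset (suc S-1)
      edges    : Subset ∣E∣
      source∈  : ∀ {e} → e ∈ edges → source e ∈ vertices
      target∈  : ∀ {e} → e ∈ edges → target e ∈ vertices

    EdgeIn : Rel State 0ℓ
    EdgeIn s t = ∃[ e ] e ∈ edges × source e ≡ s × target e ≡ t

    StronglyConnected : Set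
    StronglyConnected =
      Nonempty vertices × (∀ {s t} → s ∈ vertices → t ∈ vertices → Star EdgeIn s t)

    OutDegree1 : State → Set
    OutDegree1 s = ∃! _≡_ λ e → e ∈ edges × source e ≡ s

  record DirectedCycle : Set where
    field
      subgraph          : Subgraph
    open Subgraph subgraph public
    field
      stronglyConnected : StronglyConnected
      outDegree1        : ∀ {s} → s ∈ vertices → OutDegree1 s

  -- g(C), for g with values in any additive monoid.
  sumOver : (M : RawMonoid 0ℓ 0ℓ) → (Transition → RawMonoid.Carrier M) →
            DirectedCycle → RawMonoid.Carrier M
  sumOver M g C =
    Multiple.sum M (λ e → if does (e ∈? edges) then g e else RawMonoid.ε M)
    where open DirectedCycle C

  δ⟨_⟩ : DirectedCycle → ℝ
  δ⟨_⟩ = sumOver ℝ-+-rawMonoid (λ e → proj₁ (δ e))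

  𝟙⟨_⟩ : DirectedCycle → ℕ
  𝟙⟨_⟩ = sumOver ℕ.+-0-rawMonoid (λ _ → 1)

{-# OPTIONS --safe #-}

-- For a constant k put f(e) = δ(e) − k. Up to the final output, which takes
-- finitely many values, Output(Xₙ) − kn is the sum of f along a walk of length
-- n, so both assertions are shown equivalent to the vanishing of f on all simple
-- closed walks. If f vanishes there, erasing loops does not change the sum along
-- a walk and leaves a walk without repeated transitions, whose sum is at most
-- Σₑ |f(e)|. Conversely, repeating a closed walk m times, after a path that
-- reaches it from the initial state, adds m f(C), which is bounded in m only if
-- f(C) = 0. Simple closed walks are the traversals of the directed cycles: every
-- directed cycle contains one, by loop erasure of a path given by strong
-- connectivity, and out-degree 1 forces it to use all transitions of the cycle.

module Submission where

open import Defs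
open import Algebra.Bundles using (CommutativeMonoid)
import Algebra.Definitions.RawMonoid as RawMonoidDefinitions
import Algebra.Properties.CommutativeMonoid.Sum as CommutativeMonoidSum
open import Data.Bool.Base using (true; false; if_then_else_)
open import Data.Fin.Base using (Fin; zero; suc)
open import Data.Fin.Properties using (_≟_)
open import Data.Fin.Subset using (Subset) renaming (_∈_ to _∈ₛ_)
open import Data.Fin.Subset.Properties using () renaming (_∈?_ to _∈ₛ?_)
import Data.Integer.Base as ℤ
import Data.Integer.Properties as ℤ
open import Data.List.Base using (List; []; _∷_; _++_; concat; foldr; length; map; replicate)
import Data.List.Membership.DecPropositional as DecMembership
open import Data.List.Membership.Propositional using (_∈_; _∉_)
open import Data.List.Membership.Propositional.Properties
  using (∈-map⁺; ∈-map⁻; ∈-++⁺ˡ; ∈-++⁺ʳ)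
open import Data.List.Relation.Binary.Subset.Propositional using (_⊆_)
open import Data.List.Relation.Unary.All using ([]; _∷_)
import Data.List.Relation.Unary.All.Properties as All
open import Data.List.Relation.Unary.AllPairs using ([]; _∷_)
import Data.List.Relation.Unary.AllPairs as AllPairs
import Data.List.Relation.Unary.AllPairs.Properties as AllPairs
open import Data.List.Relation.Unary.Any using (here; there)
open import Data.List.Relation.Unary.Unique.Propositional using (Unique)
open import Data.List.Relation.Unary.Unique.Propositional.Properties
  using (Unique[x∷xs]⇒x∉xs)
open import Data.Nat.Base as ℕ using (ℕ; zero; suc)
import Data.Nat.Properties as ℕ
open import Data.Product.Base using (∃₂; ∃-syntax; _×_; _,_; proj₁; proj₂)
open import Data.Rational.Base as ℚ using (ℚ; 0ℚ; 1ℚ; ½; toℚᵘ)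
import Data.Rational.Properties as ℚ
open import Data.Rational.Solver using (module +-*-Solver)
import Data.Rational.Unnormalised.Base as ℚᵘ
import Data.Rational.Unnormalised.Properties as ℚᵘ
open import Data.Sum.Base using (_⊎_; inj₁; inj₂)
open import Data.Vec.Base using (Vec; []; _∷_; tabulate)
open import Data.Vec.Properties using ([]=⇒lookup; lookup⇒[]=; lookup∘tabulate)
open import Function.Base using (_∘_; id)
open import Function.Bundles using (_⇔_; mk⇔; module Equivalence)
open import Level using (0ℓ)
open import Relation.Binary.Construct.Closure.ReflexiveTransitive
  using (Star; _◅_; _◅◅_) renaming (ε to done)
open import Relation.Binary.PropositionalEquality
  using (_≡_; refl; sym; trans; cong; cong₂; subst; subst₂; module ≡-Reasoning)
import Relation.Binary.Reasoning.Setoid as ≈-Reasoning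
open import Relation.Nullary using (Dec; does; yes; no; contradiction)
open import Relation.Nullary.Decidable using (dec-true)
open import Relation.Unary using (Pred; Decidable)

-- Rational numbers

½-pos : ∀ {ε} → 0ℚ ℚ.< ε → 0ℚ ℚ.< ε ℚ.* ½
½-pos 0<ε = ℚ.*-monoˡ-<-pos ½ 0<ε

½+½ : ∀ ε → ε ℚ.* ½ ℚ.+ ε ℚ.* ½ ≡ ε
½+½ ε = trans (sym (ℚ.*-distribˡ-+ ε ½ ½)) (ℚ.*-identityʳ ε)

0<1 : 0ℚ ℚ.< 1ℚ
0<1 = ℚ.*<* (ℤ.+<+ (ℕ.s≤s ℕ.z≤n))

p≤∣p∣ : ∀ p → p ℚ.≤ ℚ.∣ p ∣
p≤∣p∣ p with ℚ.≤-total 0ℚ p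
... | inj₁ 0≤p = ℚ.≤-reflexive (sym (ℚ.0≤p⇒∣p∣≡p 0≤p))
... | inj₂ p≤0 = ℚ.≤-trans p≤0 (ℚ.0≤∣p∣ p)

∣-∣-comm : ∀ p q → ℚ.∣ p ℚ.- q ∣ ≡ ℚ.∣ q ℚ.- p ∣
∣-∣-comm p q = trans (sym (ℚ.∣-p∣≡∣p∣ (p ℚ.- q))) (cong ℚ.∣_∣
  (solve 2 (λ a b → :- (a :+ :- b) := b :+ :- a) refl p q))
  where open +-*-Solver

triangle : ∀ p q r → ℚ.∣ p ℚ.- r ∣ ℚ.≤ ℚ.∣ p ℚ.- q ∣ ℚ.+ ℚ.∣ q ℚ.- r ∣
triangle p q r = subst (λ d → ℚ.∣ d ∣ ℚ.≤ ℚ.∣ p ℚ.- q ∣ ℚ.+ ℚ.∣ q ℚ.- r ∣)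
  (solve 3 (λ a b c → (a :+ :- b) :+ (b :+ :- c) := a :+ :- c) refl p q r)
  (ℚ.∣p+q∣≤∣p∣+∣q∣ (p ℚ.- q) (q ℚ.- r))
  where open +-*-Solver

∣p∣≤∣p-q∣+∣q∣ : ∀ p q → ℚ.∣ p ∣ ℚ.≤ ℚ.∣ p ℚ.- q ∣ ℚ.+ ℚ.∣ q ∣
∣p∣≤∣p-q∣+∣q∣ p q = subst (λ d → ℚ.∣ d ∣ ℚ.≤ ℚ.∣ p ℚ.- q ∣ ℚ.+ ℚ.∣ q ∣)
  (solve 2 (λ a b → (a :+ :- b) :+ b := a) refl p q) (ℚ.∣p+q∣≤∣p∣+∣q∣ (p ℚ.- q) q)
  where open +-*-Solver

∣p∣-∣q∣≤∣p-q∣ : ∀ p q → ℚ.∣ p ∣ ℚ.- ℚ.∣ q ∣ ℚ.≤ ℚ.∣ p ℚ.- q ∣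
∣p∣-∣q∣≤∣p-q∣ p q = subst (ℚ.∣ p ∣ ℚ.- ℚ.∣ q ∣ ℚ.≤_)
  (solve 2 (λ a b → (a :+ b) :+ :- b := a) refl ℚ.∣ p ℚ.- q ∣ ℚ.∣ q ∣)
  (ℚ.+-monoˡ-≤ (ℚ.- ℚ.∣ q ∣) (∣p∣≤∣p-q∣+∣q∣ p q))
  where open +-*-Solver

∣∣p∣-∣q∣∣≤∣p-q∣ : ∀ p q → ℚ.∣ ℚ.∣ p ∣ ℚ.- ℚ.∣ q ∣ ∣ ℚ.≤ ℚ.∣ p ℚ.- q ∣
∣∣p∣-∣q∣∣≤∣p-q∣ p q with ℚ.∣p∣≡p∨∣p∣≡-p (ℚ.∣ p ∣ ℚ.- ℚ.∣ q ∣)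
... | inj₁ eq = subst (ℚ._≤ ℚ.∣ p ℚ.- q ∣) (sym eq) (∣p∣-∣q∣≤∣p-q∣ p q)
... | inj₂ eq = subst₂ ℚ._≤_
  (sym (trans eq (solve 2 (λ a b → :- (a :+ :- b) := b :+ :- a) refl ℚ.∣ p ∣ ℚ.∣ q ∣)))
  (∣-∣-comm q p) (∣p∣-∣q∣≤∣p-q∣ q p)
  where open +-*-Solver

a-b+[c-d]≡a+c-[b+d] : ∀ a b c d → (a ℚ.- b) ℚ.+ (c ℚ.- d) ≡ (a ℚ.+ c) ℚ.- (b ℚ.+ d)
a-b+[c-d]≡a+c-[b+d] = solve 4 (λ a b c d →
  (a :+ :- b) :+ (c :+ :- d) := (a :+ c) :+ :- (b :+ d)) refl
  where open +-*-Solver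

L-K+[d-k+X]≡d+L-[k+K]+X : ∀ L K d k X →
  (L ℚ.- K) ℚ.+ ((d ℚ.- k) ℚ.+ X) ≡ ((d ℚ.+ L) ℚ.- (k ℚ.+ K)) ℚ.+ X
L-K+[d-k+X]≡d+L-[k+K]+X = solve 5 (λ L K d k X →
  (L :+ :- K) :+ ((d :+ :- k) :+ X) := ((d :+ L) :+ :- (k :+ K)) :+ X) refl
  where open +-*-Solver

a+L-K≡a+[L-K+0] : ∀ a L K → (a ℚ.+ L) ℚ.- K ≡ a ℚ.+ ((L ℚ.- K) ℚ.+ 0ℚ)
a+L-K≡a+[L-K+0] = solve 3 (λ a L K → (a :+ L) :+ :- K := a :+ ((L :+ :- K) :+ con 0ℚ)) refl
  where open +-*-Solver

-- Natural multiples of rationals and the Archimedean property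

open RawMonoidDefinitions ℚ.+-0-rawMonoid using () renaming (_×_ to _×ℚ_)

×ℚ-*-assoc : ∀ m p q → m ×ℚ (p ℚ.* q) ≡ (m ×ℚ p) ℚ.* q
×ℚ-*-assoc zero    p q = sym (ℚ.*-zeroˡ q)
×ℚ-*-assoc (suc m) p q = trans (cong (p ℚ.* q ℚ.+_) (×ℚ-*-assoc m p q))
  (sym (ℚ.*-distribʳ-+ q p (m ×ℚ p)))

m×ℚp≡m×ℚ1*p : ∀ m p → m ×ℚ p ≡ (m ×ℚ 1ℚ) ℚ.* p
m×ℚp≡m×ℚ1*p m p = trans (cong (m ×ℚ_) (sym (ℚ.*-identityˡ p))) (×ℚ-*-assoc m 1ℚ p)

×ℚ-monoʳ-≤ : ∀ m {p q} → p ℚ.≤ q → m ×ℚ p ℚ.≤ m ×ℚ q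
×ℚ-monoʳ-≤ zero    p≤q = ℚ.≤-refl
×ℚ-monoʳ-≤ (suc m) p≤q = ℚ.+-mono-≤ p≤q (×ℚ-monoʳ-≤ m p≤q)

0≤m×ℚ1 : ∀ m → 0ℚ ℚ.≤ m ×ℚ 1ℚ
0≤m×ℚ1 zero    = ℚ.≤-refl
0≤m×ℚ1 (suc m) = ℚ.+-mono-≤ (ℚ.<⇒≤ 0<1) (0≤m×ℚ1 m)

∣m×ℚp∣≡m×ℚ∣p∣ : ∀ m p → ℚ.∣ m ×ℚ p ∣ ≡ m ×ℚ ℚ.∣ p ∣
∣m×ℚp∣≡m×ℚ∣p∣ m p = begin
  ℚ.∣ m ×ℚ p ∣                ≡⟨ cong ℚ.∣_∣ (m×ℚp≡m×ℚ1*p m p) ⟩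
  ℚ.∣ (m ×ℚ 1ℚ) ℚ.* p ∣       ≡⟨ ℚ.∣p*q∣≡∣p∣*∣q∣ (m ×ℚ 1ℚ) p ⟩
  ℚ.∣ m ×ℚ 1ℚ ∣ ℚ.* ℚ.∣ p ∣   ≡⟨ cong (ℚ._* ℚ.∣ p ∣) (ℚ.0≤p⇒∣p∣≡p (0≤m×ℚ1 m)) ⟩
  (m ×ℚ 1ℚ) ℚ.* ℚ.∣ p ∣       ≡⟨ sym (m×ℚp≡m×ℚ1*p m ℚ.∣ p ∣) ⟩
  m ×ℚ ℚ.∣ p ∣ ∎
  where open ≡-Reasoning

toℚᵘ-×ℚ1 : ∀ m → toℚᵘ (m ×ℚ 1ℚ) ℚᵘ.≃ ℚᵘ.mkℚᵘ (ℤ.+ m) 0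
toℚᵘ-×ℚ1 zero    = ℚᵘ.≃-refl
toℚᵘ-×ℚ1 (suc m) = ℚᵘ.≃-trans (ℚ.toℚᵘ-homo-+ 1ℚ (m ×ℚ 1ℚ))
  (ℚᵘ.≃-trans (ℚᵘ.+-congʳ ℚᵘ.1ℚᵘ (toℚᵘ-×ℚ1 m))
    (ℚᵘ.*≡* (cong (λ k → (ℤ.1ℤ ℤ.+ k) ℤ.* ℤ.1ℤ) (ℤ.*-identityʳ (ℤ.+ m)))))

-- A denominator is at least 1, so dropping it can only increase a nonnegative fraction, and a
-- negative one lies below every natural number. The comparison takes place among unnormalised
-- fractions, where no common factors have to be cancelled.
p≤∣↥p∣×ℚ1 : ∀ p → p ℚ.≤ ℤ.∣ ℚ.↥ p ∣ ×ℚ 1ℚ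
p≤∣↥p∣×ℚ1 p@record{} = ℚ.toℚᵘ-cancel-≤
  (ℚᵘ.≤-respʳ-≃ (ℚᵘ.≃-sym (toℚᵘ-×ℚ1 ℤ.∣ ℚ.↥ p ∣)) (≤∣num∣ (ℚ.↥ p) (ℚ.denominator-1 p)))
  where
  ≤∣num∣ : ∀ n d → ℚᵘ.mkℚᵘ n d ℚᵘ.≤ ℚᵘ.mkℚᵘ (ℤ.+ ℤ.∣ n ∣) 0
  ≤∣num∣ (ℤ.+ n)    d = ℚᵘ.*≤*
    (ℤ.*-monoˡ-≤-nonNeg (ℤ.+ n) {ℤ.1ℤ} {ℤ.+ suc d} (ℤ.+≤+ (ℕ.s≤s ℕ.z≤n)))
  ≤∣num∣ ℤ.-[1+ n ] d = ℚᵘ.*≤* ℤ.-≤+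

-- The multiple is the absolute numerator of `(p + 1) / q`; passing from `p` to `p + 1` makes the
-- inequality strict.
archimedean : ∀ p {q} → 0ℚ ℚ.< q → ∃[ m ] p ℚ.< m ×ℚ q
archimedean p {q} 0<q = m , (begin-strict
  p                             ≡⟨ sym (ℚ.+-identityʳ p) ⟩
  p ℚ.+ 0ℚ                      <⟨ ℚ.+-monoʳ-< p 0<1 ⟩
  p ℚ.+ 1ℚ                      ≡⟨ sym (ℚ.*-identityʳ (p ℚ.+ 1ℚ)) ⟩
  (p ℚ.+ 1ℚ) ℚ.* 1ℚ             ≡⟨ cong ((p ℚ.+ 1ℚ) ℚ.*_) (sym (ℚ.*-inverseˡ q)) ⟩
  (p ℚ.+ 1ℚ) ℚ.* (ℚ.1/ q ℚ.* q) ≡⟨ sym (ℚ.*-assoc (p ℚ.+ 1ℚ) (ℚ.1/ q) q) ⟩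
  r ℚ.* q                       ≤⟨ ℚ.*-monoʳ-≤-nonNeg q (p≤∣↥p∣×ℚ1 r) ⟩
  (m ×ℚ 1ℚ) ℚ.* q               ≡⟨ sym (m×ℚp≡m×ℚ1*p m q) ⟩
  m ×ℚ q                        ∎)
  where
  open ℚ.≤-Reasoning
  instance
    q≢0 : ℚ.NonZero q
    q≢0 = ℚ.>-nonZero 0<q
    q≥0 : ℚ.NonNegative q
    q≥0 = ℚ.nonNegative (ℚ.<⇒≤ 0<q)
  r = (p ℚ.+ 1ℚ) ℚ.* ℚ.1/ q
  m = ℤ.∣ ℚ.↥ r ∣

-- Real numbers

-- Keeps the modulus of a known equality whenever the new error is at no index larger than the old
-- one; this covers symmetry, absolute values and comparison of a difference with zero.
≃-from₁ : ∀ {x x′ u v} → x ≃ x′ →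
  (∀ i → ℚ.∣ seq u i ℚ.- seq v i ∣ ℚ.≤ ℚ.∣ seq x i ℚ.- seq x′ i ∣) → u ≃ v
≃-from₁ x≃x′ bound ε 0<ε with N , close ← x≃x′ ε 0<ε =
  N , λ i N≤i → ℚ.≤-<-trans (bound i) (close i N≤i)

-- The two-error analogue, with the tolerance halved, from which transitivity and the congruence of
-- addition follow.
≃-from₂ : ∀ {x x′ y y′ u v} → x ≃ x′ → y ≃ y′ →
  (∀ i → ℚ.∣ seq u i ℚ.- seq v i ∣ ℚ.≤
         ℚ.∣ seq x i ℚ.- seq x′ i ∣ ℚ.+ ℚ.∣ seq y i ℚ.- seq y′ i ∣) → u ≃ v
≃-from₂ x≃x′ y≃y′ bound ε 0<ε
  with M , x-close ← x≃x′ (ε ℚ.* ½) (½-pos 0<ε)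
     | N , y-close ← y≃y′ (ε ℚ.* ½) (½-pos 0<ε) =
  M ℕ.⊔ N , λ i M⊔N≤i → ℚ.≤-<-trans (bound i) (subst (_ ℚ.<_) (½+½ ε)
    (ℚ.+-mono-< (x-close i (ℕ.m⊔n≤o⇒m≤o M N M⊔N≤i)) (y-close i (ℕ.m⊔n≤o⇒n≤o M N M⊔N≤i))))

≗⇒≃ : ∀ x y → (∀ i → seq x i ≡ seq y i) → x ≃ y
≗⇒≃ x y eq ε 0<ε = 0 , λ i _ → subst (ℚ._< ε)
  (sym (trans (cong (λ q → ℚ.∣ seq x i ℚ.- q ∣) (sym (eq i)))
              (cong ℚ.∣_∣ (ℚ.+-inverseʳ (seq x i))))) 0<ε

≃-refl : ∀ {x} → x ≃ x
≃-refl {x} = ≗⇒≃ x x λ _ → refl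

≃-sym : ∀ {x y} → x ≃ y → y ≃ x
≃-sym {x} {y} x≃y = ≃-from₁ {x} {y} {y} {x} x≃y λ i →
  ℚ.≤-reflexive (∣-∣-comm (seq y i) (seq x i))

≃-trans : ∀ {x y z} → x ≃ y → y ≃ z → x ≃ z
≃-trans {x} {y} {z} x≃y y≃z = ≃-from₂ {x} {y} {y} {z} {x} {z} x≃y y≃z λ i →
  triangle (seq x i) (seq y i) (seq z i)

+ᴿ-cong : ∀ {x x′ y y′} → x ≃ x′ → y ≃ y′ → x +ᴿ y ≃ x′ +ᴿ y′
+ᴿ-cong {x} {x′} {y} {y′} x≃x′ y≃y′ =
  ≃-from₂ {x} {x′} {y} {y′} {x +ᴿ y} {x′ +ᴿ y′} x≃x′ y≃y′ λ i →
    ℚ.≤-trans (ℚ.≤-reflexive (cong ℚ.∣_∣ (solve 4 (λ a b c d →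
      (a :+ b) :+ :- (c :+ d) := (a :+ :- c) :+ (b :+ :- d)) refl
      (seq x i) (seq y i) (seq x′ i) (seq y′ i))))
    (ℚ.∣p+q∣≤∣p∣+∣q∣ (seq x i ℚ.- seq x′ i) (seq y i ℚ.- seq y′ i))
  where open +-*-Solver

∣∣ᴿ-cong : ∀ {x y} → x ≃ y → ∣ x ∣ᴿ ≃ ∣ y ∣ᴿ
∣∣ᴿ-cong {x} {y} x≃y = ≃-from₁ {x} {y} {∣ x ∣ᴿ} {∣ y ∣ᴿ} x≃y λ i →
  ∣∣p∣-∣q∣∣≤∣p-q∣ (seq x i) (seq y i)

x-y≃0⇒x≃y : ∀ {x y} → x -ᴿ y ≃ 0ᴿ → x ≃ y
x-y≃0⇒x≃y {x} {y} x-y≃0 = ≃-from₁ {x -ᴿ y} {0ᴿ} {x} {y} x-y≃0 λ i →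
  ℚ.≤-reflexive (cong ℚ.∣_∣ (sym (ℚ.+-identityʳ (seq x i ℚ.- seq y i))))

x≃y⇒x-y≃0 : ∀ {x y} → x ≃ y → x -ᴿ y ≃ 0ᴿ
x≃y⇒x-y≃0 {x} {y} x≃y = ≃-from₁ {x} {y} {x -ᴿ y} {0ᴿ} x≃y λ i →
  ℚ.≤-reflexive (cong ℚ.∣_∣ (ℚ.+-identityʳ (seq x i ℚ.- seq y i)))

ℝ-+-commutativeMonoid : CommutativeMonoid 0ℓ 0ℓ
ℝ-+-commutativeMonoid = record
  { Carrier = ℝ ; _≈_ = _≃_ ; _∙_ = _+ᴿ_ ; ε = 0ᴿ
  ; isCommutativeMonoid = record
    { isMonoid = record
      { isSemigroup = record
        { isMagma = record
          { isEquivalence = record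
            { refl  = λ {x} → ≃-refl {x}
            ; sym   = λ {x} {y} → ≃-sym {x} {y}
            ; trans = λ {x} {y} {z} → ≃-trans {x} {y} {z}
            }
          ; ∙-cong = λ {x} {x′} {y} {y′} → +ᴿ-cong {x} {x′} {y} {y′}
          }
        ; assoc = λ x y z → ≗⇒≃ (x +ᴿ y +ᴿ z) (x +ᴿ (y +ᴿ z)) λ i →
            ℚ.+-assoc (seq x i) (seq y i) (seq z i)
        }
      ; identity = (λ x → ≗⇒≃ (0ᴿ +ᴿ x) x λ i → ℚ.+-identityˡ (seq x i)) ,
                   (λ x → ≗⇒≃ (x +ᴿ 0ᴿ) x λ i → ℚ.+-identityʳ (seq x i))
      }
    ; comm = λ x y → ≗⇒≃ (x +ᴿ y) (y +ᴿ x) λ i → ℚ.+-comm (seq x i) (seq y i)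
    }
  }

pointwise⇒≤ᴿ : ∀ {x y} → (∀ i → seq x i ℚ.≤ seq y i) → x ≤ᴿ y
pointwise⇒≤ᴿ {x} {y} x≤y ε 0<ε = 0 , λ i _ →
  ℚ.≤-<-trans (x≤y i) (subst (ℚ._< seq y i ℚ.+ ε) (ℚ.+-identityʳ (seq y i))
    (ℚ.+-monoʳ-< (seq y i) 0<ε))

≤ᴿ-trans : ∀ {x y z} → x ≤ᴿ y → y ≤ᴿ z → x ≤ᴿ z
≤ᴿ-trans {x} {y} {z} x≤y y≤z ε 0<ε
  with M , x<y ← x≤y (ε ℚ.* ½) (½-pos 0<ε) | N , y<z ← y≤z (ε ℚ.* ½) (½-pos 0<ε) =
  M ℕ.⊔ N , λ i M⊔N≤i → begin-strict
    seq x i                               <⟨ x<y i (ℕ.m⊔n≤o⇒m≤o M N M⊔N≤i) ⟩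
    seq y i ℚ.+ ε ℚ.* ½                   <⟨ ℚ.+-monoˡ-< (ε ℚ.* ½) (y<z i (ℕ.m⊔n≤o⇒n≤o M N M⊔N≤i)) ⟩
    seq z i ℚ.+ ε ℚ.* ½ ℚ.+ ε ℚ.* ½       ≡⟨ ℚ.+-assoc (seq z i) _ _ ⟩
    seq z i ℚ.+ (ε ℚ.* ½ ℚ.+ ε ℚ.* ½)     ≡⟨ cong (seq z i ℚ.+_) (½+½ ε) ⟩
    seq z i ℚ.+ ε                         ∎
  where open ℚ.≤-Reasoning

≃⇒≤ᴿ : ∀ {x y} → x ≃ y → x ≤ᴿ y
≃⇒≤ᴿ {x} {y} x≃y ε 0<ε with N , close ← x≃y ε 0<ε = N , λ i N≤i → begin-strict
  seq x i
    ≡⟨ solve 2 (λ a b → a := b :+ (a :+ :- b)) refl (seq x i) (seq y i) ⟩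
  seq y i ℚ.+ (seq x i ℚ.- seq y i)     ≤⟨ ℚ.+-monoʳ-≤ (seq y i) (p≤∣p∣ _) ⟩
  seq y i ℚ.+ ℚ.∣ seq x i ℚ.- seq y i ∣ <⟨ ℚ.+-monoʳ-< (seq y i) (close i N≤i) ⟩
  seq y i ℚ.+ ε                         ∎
  where
  open ℚ.≤-Reasoning
  open +-*-Solver

-- With tolerance 1 the Cauchy condition keeps the tail within 1 of its first entry.
eventually-bounded : ∀ x → ∃₂ λ b N → ∀ i → N ℕ.≤ i → ℚ.∣ seq x i ∣ ℚ.< b
eventually-bounded x with N , close ← cauchy x 1ℚ 0<1 =
  1ℚ ℚ.+ ℚ.∣ seq x N ∣ , N , λ i N≤i → ℚ.≤-<-trans (∣p∣≤∣p-q∣+∣q∣ (seq x i) (seq x N))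
    (ℚ.+-monoˡ-< ℚ.∣ seq x N ∣ (close i N N≤i ℕ.≤-refl))

seq-· : ∀ m x i → seq (m · x) i ≡ m ×ℚ seq x i
seq-· zero    x i = refl
seq-· (suc m) x i = cong (seq x i ℚ.+_) (seq-· m x i)

-- The triangle inequality gives `m |p| ≤ |q + m p| + |q| < m e`; since multiplication by `m` is
-- monotone, `e ≤ |p|` is impossible. No division by `m` is involved.
multiple-bound : ∀ m p q {b c e} → ℚ.∣ q ℚ.+ m ×ℚ p ∣ ℚ.< b → ℚ.∣ q ∣ ℚ.< c →
  b ℚ.+ c ℚ.< m ×ℚ e → ℚ.∣ p ∣ ℚ.< e
multiple-bound m p q {b} {c} {e} q+mp<b q<c b+c<me =
  ℚ.≰⇒> λ e≤p → ℚ.<-irrefl refl (ℚ.<-≤-trans mp<me (×ℚ-monoʳ-≤ m e≤p))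
  where
  open ℚ.≤-Reasoning
  open +-*-Solver
  mp<me : m ×ℚ ℚ.∣ p ∣ ℚ.< m ×ℚ e
  mp<me = begin-strict
    m ×ℚ ℚ.∣ p ∣
      ≡⟨ sym (∣m×ℚp∣≡m×ℚ∣p∣ m p) ⟩
    ℚ.∣ m ×ℚ p ∣
      ≡⟨ cong ℚ.∣_∣ (solve 2 (λ a b → a := (b :+ a) :+ :- b) refl (m ×ℚ p) q) ⟩
    ℚ.∣ (q ℚ.+ m ×ℚ p) ℚ.- q ∣
      ≤⟨ ℚ.∣p-q∣≤∣p∣+∣q∣ (q ℚ.+ m ×ℚ p) q ⟩
    ℚ.∣ q ℚ.+ m ×ℚ p ∣ ℚ.+ ℚ.∣ q ∣
      <⟨ ℚ.+-mono-< q+mp<b q<c ⟩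
    b ℚ.+ c
      <⟨ b+c<me ⟩
    m ×ℚ e ∎

-- The index from which the bound for `m · x` takes effect depends on `m`, so `m` is fixed first,
-- according to the tolerance. The bound then makes `x` small at one late index `n`, and the Cauchy
-- condition carries this over to all indices from `N₁` on.
bounded-multiples⇒≃0 : ∀ x y B → (∀ m → ∣ y +ᴿ m · x ∣ᴿ ≤ᴿ B) → x ≃ 0ᴿ
bounded-multiples⇒≃0 x y B bounded ε 0<ε = small (cauchy x (ε ℚ.* ½) (½-pos 0<ε))
  (eventually-bounded y) (eventually-bounded B)
  where
  open ℚ.≤-Reasoning
  small : (∃[ N ] ∀ m n → N ℕ.≤ m → N ℕ.≤ n → ℚ.∣ seq x m ℚ.- seq x n ∣ ℚ.< ε ℚ.* ½) →
    (∃₂ λ b N → ∀ i → N ℕ.≤ i → ℚ.∣ seq y i ∣ ℚ.< b) →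
    (∃₂ λ b N → ∀ i → N ℕ.≤ i → ℚ.∣ seq B i ∣ ℚ.< b) →
    ∃[ N ] ∀ n → N ℕ.≤ n → ℚ.∣ seq x n ℚ.- 0ℚ ∣ ℚ.< ε
  small (N₁ , close) (c , N₂ , y<c) (b , N₃ , B<b) = N₁ , λ i N₁≤i → begin-strict
    ℚ.∣ seq x i ℚ.- 0ℚ ∣                        ≡⟨ cong ℚ.∣_∣ (ℚ.+-identityʳ (seq x i)) ⟩
    ℚ.∣ seq x i ∣                               ≤⟨ ∣p∣≤∣p-q∣+∣q∣ (seq x i) (seq x n) ⟩
    ℚ.∣ seq x i ℚ.- seq x n ∣ ℚ.+ ℚ.∣ seq x n ∣ <⟨ ℚ.+-mono-< (close i n N₁≤i N₁≤n) xn-small ⟩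
    ε ℚ.* ½ ℚ.+ ε ℚ.* ½                         ≡⟨ ½+½ ε ⟩
    ε                                           ∎
    where
    -- The summand `1ℚ` absorbs the tolerance with which the bound by `B` is used in `stage`.
    large : ∃[ m ] (b ℚ.+ 1ℚ) ℚ.+ c ℚ.< m ×ℚ (ε ℚ.* ½)
    large = archimedean ((b ℚ.+ 1ℚ) ℚ.+ c) (½-pos 0<ε)
    m = proj₁ large
    stage : ∃[ N ] ∀ n → N ℕ.≤ n → ℚ.∣ seq y n ℚ.+ seq (m · x) n ∣ ℚ.< seq B n ℚ.+ 1ℚ
    stage = bounded m 1ℚ 0<1
    N₄ = proj₁ stage
    n = (N₁ ℕ.⊔ N₂) ℕ.⊔ (N₃ ℕ.⊔ N₄)
    N₁≤n : N₁ ℕ.≤ n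
    N₁≤n = ℕ.≤-trans (ℕ.m≤m⊔n N₁ N₂) (ℕ.m≤m⊔n _ (N₃ ℕ.⊔ N₄))
    N₂≤n : N₂ ℕ.≤ n
    N₂≤n = ℕ.≤-trans (ℕ.m≤n⊔m N₁ N₂) (ℕ.m≤m⊔n _ (N₃ ℕ.⊔ N₄))
    N₃≤n : N₃ ℕ.≤ n
    N₃≤n = ℕ.≤-trans (ℕ.m≤m⊔n N₃ N₄) (ℕ.m≤n⊔m (N₁ ℕ.⊔ N₂) _)
    N₄≤n : N₄ ℕ.≤ n
    N₄≤n = ℕ.≤-trans (ℕ.m≤n⊔m N₃ N₄) (ℕ.m≤n⊔m (N₁ ℕ.⊔ N₂) _)
    xn-small : ℚ.∣ seq x n ∣ ℚ.< ε ℚ.* ½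
    xn-small = multiple-bound m (seq x n) (seq y n)
      (ℚ.<-trans
        (subst (λ r → ℚ.∣ seq y n ℚ.+ r ∣ ℚ.< seq B n ℚ.+ 1ℚ) (seq-· m x n) (proj₂ stage n N₄≤n))
        (ℚ.+-monoˡ-< 1ℚ (ℚ.≤-<-trans (p≤∣p∣ (seq B n)) (B<b n N₃≤n))))
      (y<c n N₂≤n) (proj₂ large)

+ᴿ-mono-≤ᴿ : ∀ {x x′ y y′} → x ≤ᴿ x′ → y ≤ᴿ y′ → x +ᴿ y ≤ᴿ x′ +ᴿ y′
+ᴿ-mono-≤ᴿ {x} {x′} {y} {y′} x≤x′ y≤y′ ε 0<ε
  with M , x<x′ ← x≤x′ (ε ℚ.* ½) (½-pos 0<ε) | N , y<y′ ← y≤y′ (ε ℚ.* ½) (½-pos 0<ε) =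
  M ℕ.⊔ N , λ i M⊔N≤i → begin-strict
    seq x i ℚ.+ seq y i
      <⟨ ℚ.+-mono-< (x<x′ i (ℕ.m⊔n≤o⇒m≤o M N M⊔N≤i)) (y<y′ i (ℕ.m⊔n≤o⇒n≤o M N M⊔N≤i)) ⟩
    (seq x′ i ℚ.+ ε ℚ.* ½) ℚ.+ (seq y′ i ℚ.+ ε ℚ.* ½)
      ≡⟨ solve 3 (λ a b e → (a :+ e) :+ (b :+ e) := (a :+ b) :+ (e :+ e)) refl
           (seq x′ i) (seq y′ i) (ε ℚ.* ½) ⟩
    (seq x′ i ℚ.+ seq y′ i) ℚ.+ (ε ℚ.* ½ ℚ.+ ε ℚ.* ½)
      ≡⟨ cong (seq x′ i ℚ.+ seq y′ i ℚ.+_) (½+½ ε) ⟩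
    (seq x′ i ℚ.+ seq y′ i) ℚ.+ ε ∎
  where
  open ℚ.≤-Reasoning
  open +-*-Solver

+ᴿ-congˡ : ∀ x {y y′} → y ≃ y′ → x +ᴿ y ≃ x +ᴿ y′
+ᴿ-congˡ x {y} {y′} = +ᴿ-cong {x} {x} {y} {y′} (≃-refl {x})

∣∣ᴿ-≤ᴿ-resp-≃ : ∀ {x y B} → x ≃ y → ∣ x ∣ᴿ ≤ᴿ B → ∣ y ∣ᴿ ≤ᴿ B
∣∣ᴿ-≤ᴿ-resp-≃ {x} {y} {B} x≃y = ≤ᴿ-trans {∣ y ∣ᴿ} {∣ x ∣ᴿ} {B}
  (≃⇒≤ᴿ {∣ y ∣ᴿ} {∣ x ∣ᴿ} (∣∣ᴿ-cong {y} {x} (≃-sym {x} {y} x≃y)))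

≃-shift-resp : ∀ k {z x x′ m m′} → z ≃ x -ᴿ m · k → x′ ≃ x → m′ ≡ m → z ≃ x′ -ᴿ m′ · k
≃-shift-resp k {z} {x} {x′} {m} z≃ x′≃x refl =
  ≃-trans {z} {x -ᴿ m · k} {x′ -ᴿ m · k} z≃
    (+ᴿ-cong {x} {x′} { -ᴿ (m · k)} { -ᴿ (m · k)} (≃-sym {x′} {x} x′≃x) (≃-refl { -ᴿ (m · k)}))

≃-reassoc : ∀ {u a z b p q} → u ≃ a +ᴿ z → z ≃ b +ᴿ p → p ≃ q → u ≃ (a +ᴿ b) +ᴿ q
≃-reassoc {u} {a} {z} {b} {p} {q} u≃ z≃ p≃q = begin
  u             ≈⟨ u≃ ⟩
  a +ᴿ z        ≈⟨ +ᴿ-congˡ a {z} {b +ᴿ p} z≃ ⟩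
  a +ᴿ (b +ᴿ p) ≈⟨ assoc a b p ⟨
  (a +ᴿ b) +ᴿ p ≈⟨ +ᴿ-congˡ (a +ᴿ b) {p} {q} p≃q ⟩
  (a +ᴿ b) +ᴿ q ∎
  where
  open CommutativeMonoid ℝ-+-commutativeMonoid using (setoid; assoc)
  open ≈-Reasoning setoid

-- Finite sums

open Equivalence using (to; from)

_∈?_ : ∀ {n} (x : Fin n) (xs : List (Fin n)) → Dec (x ∈ xs)
_∈?_ = DecMembership._∈?_ _≟_

module ListSum (M : CommutativeMonoid 0ℓ 0ℓ) where
  open CommutativeMonoid M renaming (refl to ≈-refl; sym to ≈-sym; trans to ≈-trans)
  open CommutativeMonoidSum M
  open ≈-Reasoning setoid

  listSum : {A : Set} → (A → Carrier) → List A → Carrier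
  listSum g = foldr (λ x s → g x ∙ s) (CommutativeMonoid.ε M)

  listSum-++ : {A : Set} (g : A → Carrier) (xs {ys} : List A) →
    listSum g (xs ++ ys) ≈ listSum g xs ∙ listSum g ys
  listSum-++ g []       = ≈-sym (identityˡ _)
  listSum-++ g (x ∷ xs) = ≈-trans (∙-congˡ (listSum-++ g xs)) (≈-sym (assoc _ _ _))

  private
    0# = CommutativeMonoid.ε M

  sum-singleton : ∀ {n} (g : Fin n → Carrier) x →
    sum (λ y → if does (y ≟ x) then g y else 0#) ≈ g x
  sum-singleton {suc n} g zero    = ≈-trans (∙-congˡ (sum-replicate-zero n)) (identityʳ _)
  sum-singleton {suc n} g (suc x) = ≈-trans (identityˡ _) (sum-singleton (g ∘ suc) x)

  -- Connects sums over a subset with sums along a list that enumerates it. The indicator of the set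
  -- is the indicator of the head plus that of the tail, so the induction continues with membership
  -- in the tail as the predicate.
  sum-indicator : ∀ {n} (g : Fin n → Carrier) {P : Pred (Fin n) 0ℓ} (P? : Decidable P)
    {xs} → Unique xs → (∀ {x} → P x ⇔ (x ∈ xs)) →
    sum (λ x → if does (P? x) then g x else 0#) ≈ listSum g xs
  sum-indicator {n} g P? {[]} _ P⇔ = ≈-trans (sum-cong-≋ vanish) (sum-replicate-zero n)
    where
    vanish : ∀ x → (if does (P? x) then g x else 0#) ≈ 0#
    vanish x with P? x
    ... | yes p = contradiction (to P⇔ p) λ ()
    ... | no  _ = ≈-refl
  sum-indicator g P? {x ∷ xs} u@(_ ∷ xs!) P⇔ = begin
    sum (λ y → if does (P? y) then g y else 0#)
      ≈⟨ sum-cong-≋ split ⟩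
    sum (λ y → (if does (y ≟ x) then g y else 0#) ∙ (if does (y ∈? xs) then g y else 0#))
      ≈⟨ ∑-distrib-+ (λ y → if does (y ≟ x) then g y else 0#) _ ⟩
    sum (λ y → if does (y ≟ x) then g y else 0#) ∙
    sum (λ y → if does (y ∈? xs) then g y else 0#)
      ≈⟨ ∙-cong (sum-singleton g x) (sum-indicator g (λ y → y ∈? xs) xs! (mk⇔ id id)) ⟩
    g x ∙ listSum g xs ∎
    where
    split : ∀ y → (if does (P? y) then g y else 0#) ≈
      (if does (y ≟ x) then g y else 0#) ∙ (if does (y ∈? xs) then g y else 0#)
    -- Absence of repetitions excludes that both indicators on the right are 1.
    split y with P? y | y ≟ x | y ∈? xs
    ... | _     | yes refl | yes y∈xs = contradiction y∈xs (Unique[x∷xs]⇒x∉xs u)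
    ... | yes _ | yes _    | no _     = ≈-sym (identityʳ _)
    ... | no ¬p | yes refl | no _     = contradiction (from P⇔ (here refl)) ¬p
    ... | yes _ | no _     | yes _    = ≈-sym (identityˡ _)
    ... | no ¬p | no _     | yes y∈xs = contradiction (from P⇔ (there y∈xs)) ¬p
    ... | no _  | no _     | no _     = ≈-sym (identityˡ _)
    ... | yes p | no y≢x   | no y∉xs  with to P⇔ p
    ...   | here y≡x   = contradiction y≡x y≢x
    ...   | there y∈xs = contradiction y∈xs y∉xs

-- Walks and directed cycles

subsetOf : ∀ {n} → List (Fin n) → Subset n
subsetOf xs = tabulate λ x → does (x ∈? xs)

∈-subsetOf : ∀ {n} (xs : List (Fin n)) {x} → x ∈ₛ subsetOf xs ⇔ (x ∈ xs)
∈-subsetOf xs {x} = mk⇔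
  (λ x∈ → witness (x ∈? xs) (trans (sym (lookup∘tabulate _ x)) ([]=⇒lookup x∈)))
  (λ x∈ → lookup⇒[]= x _ (trans (lookup∘tabulate _ x) (dec-true (x ∈? xs) x∈)))
  where
  witness : {P : Set} (P? : Dec P) → does P? ≡ true → P
  witness (yes p) _ = p

Unique-map⁻ : {A B : Set} (f : A → B) {xs : List A} → Unique (map f xs) → Unique xs
Unique-map⁻ f u = AllPairs.map (λ fx≢fy x≡y → fx≢fy (cong f x≡y)) (AllPairs.map⁻ u)

-- Applied to `source`, this shows that no two transitions of a simple closed walk leave the same
-- state.
Unique-map-injective : {A B : Set} (f : A → B) {xs : List A} → Unique (map f xs) →
  ∀ {x y} → x ∈ xs → y ∈ xs → f x ≡ f y → x ≡ y
Unique-map-injective f u           (here refl) (here refl) _  = refl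
Unique-map-injective f (_ ∷ u)     (there x∈)  (there y∈)  eq = Unique-map-injective f u x∈ y∈ eq
Unique-map-injective f u           (here refl) (there y∈)  eq =
  contradiction (subst (_∈ map f _) (sym eq) (∈-map⁺ f y∈)) (Unique[x∷xs]⇒x∉xs u)
Unique-map-injective f u           (there x∈)  (here refl) eq =
  contradiction (subst (_∈ map f _) eq (∈-map⁺ f x∈)) (Unique[x∷xs]⇒x∉xs u)

module Walks (T : Transducer) where
  open Transducer T

  IsWalk : State → List Transition → State → Set
  IsWalk s []       t = s ≡ t
  IsWalk s (e ∷ es) t = source e ≡ s × IsWalk (target e) es t

  IsWalk-++ : ∀ {s t u} es {es′} → IsWalk s es t → IsWalk t es′ u → IsWalk s (es ++ es′) u
  IsWalk-++ []       refl     w′ = w′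
  IsWalk-++ (e ∷ es) (eq , w) w′ = eq , IsWalk-++ es w w′

  -- Simple closed walks and loop erasure

  sources : List Transition → List State
  sources = map source

  -- The condition `s ∈ sources c` rules out the empty walk. Distinct sources mean that no state is
  -- passed twice, and hence that no transition is repeated.
  SimpleCycle : List Transition → Set
  SimpleCycle c = ∃[ s ] s ∈ sources c × IsWalk s c s × Unique (sources c)

  -- The cut is made at the first visit to `s`, so that `p` avoids `s` and a transition leaving `s`
  -- can be put in front of `p` without repeating a source.
  splitAt : ∀ {s t u} es → IsWalk u es t → Unique (sources es) → s ∈ sources es →
    ∃₂ λ p q → es ≡ p ++ q × IsWalk u p s × s ∉ sources p × Unique (sources p) ×
               IsWalk s q t × Unique (sources q)
  splitAt {s} (e ∷ es) (eq , w) u@(e∉ ∷ es!) s∈ with source e ≟ s | s∈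
  ... | yes refl | _          = [] , e ∷ es , refl , sym eq , (λ ()) , [] , (refl , w) , u
  ... | no s≢    | here s≡    = contradiction (sym s≡) s≢
  ... | no s≢    | there s∈es
    with p , q , refl , wp , s∉p , p! , wq , q! ← splitAt es w es! s∈es =
    e ∷ p , q , refl , (eq , wp) ,
    (λ { (here s≡) → s≢ (sym s≡) ; (there s∈p) → s∉p s∈p }) ,
    All.map⁺ (All.++⁻ˡ p (All.map⁻ e∉)) ∷ p! , wq , q!

  -- Only `source e` can become a repeated source. If it does, the part of `es` up to the visit to
  -- `source e` is closed up by `e` to a simple closed walk, and the rest is a simple walk.
  prepend : ∀ {t} e es → IsWalk (target e) es t → Unique (sources es) →
    source e ∉ sources es ⊎
    ∃₂ λ p q → es ≡ p ++ q × SimpleCycle (e ∷ p) ×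
               IsWalk (source e) q t × Unique (sources q)
  prepend e es w es! with source e ∈? sources es
  ... | no  s∉ = inj₁ s∉
  ... | yes s∈ with p , q , eq , wp , s∉p , p! , wq , q! ← splitAt es w es! s∈ =
    inj₂ (p , q , eq ,
      (source e , here refl , (refl , wp) , All.¬Any⇒All¬ _ s∉p ∷ p!) , wq , q!)

  module _ (M : CommutativeMonoid 0ℓ 0ℓ) where
    open CommutativeMonoid M using (Carrier; _≈_) renaming (ε to 0#)
    open ListSum M

    VanishesOnCycles : (Transition → Carrier) → Set
    VanishesOnCycles f = ∀ c → SimpleCycle c → listSum f c ≈ 0#

    SameSum : List Transition → List Transition → Set
    SameSum es es′ = ∀ f → VanishesOnCycles f → listSum f es ≈ listSum f es′

  -- The tail is erased first, so each further transition closes at most one loop, and that loop is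
  -- simple; removing it changes no sum that vanishes on simple closed walks. The inclusion
  -- `es′ ⊆ es` is kept so that erasure inside a subgraph stays inside it.
  loopErase : ∀ {s t} es → IsWalk s es t →
    ∃[ es′ ] IsWalk s es′ t × Unique (sources es′) × es′ ⊆ es × (∀ M → SameSum M es es′)
  loopErase []       w          = [] , w , [] , id , λ M _ _ → CommutativeMonoid.refl M
  loopErase (e ∷ es) (refl , w)
    with es′ , w′ , es′! , es′⊆es , same ← loopErase es w
    with prepend e es′ w′ es′!
  ... | inj₁ s∉ =
    e ∷ es′ , (refl , w′) , All.¬Any⇒All¬ _ s∉ ∷ es′! ,
    (λ { (here eq) → here eq ; (there x∈) → there (es′⊆es x∈) }) ,
    λ M f vanish → CommutativeMonoid.∙-congˡ M (same M f vanish)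
  ... | inj₂ (p , q , refl , cycle , wq , q!) =
    q , wq , q! , (λ x∈ → there (es′⊆es (∈-++⁺ʳ p x∈))) , sameSum
    where
    sameSum : ∀ M → SameSum M (e ∷ es) q
    sameSum M f vanish = begin
      listSum f (e ∷ es)              ≈⟨ ∙-congˡ (same M f vanish) ⟩
      listSum f ((e ∷ p) ++ q)        ≈⟨ listSum-++ f (e ∷ p) ⟩
      listSum f (e ∷ p) ∙ listSum f q ≈⟨ ∙-congʳ (vanish (e ∷ p) cycle) ⟩
      0# ∙ listSum f q                ≈⟨ identityˡ _ ⟩
      listSum f q                     ∎
      where
      open CommutativeMonoid M using (_∙_; ∙-congˡ; ∙-congʳ; identityˡ; setoid) renaming (ε to 0#)
      open ListSum M
      open ≈-Reasoning setoid

  target-closed : ∀ {s t} es → IsWalk s es t → ∀ {e} → e ∈ es →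
    target e ∈ sources es ⊎ target e ≡ t
  target-closed (e ∷ [])      (_ , eq)     (here refl) = inj₂ eq
  target-closed (e ∷ e′ ∷ es) (_ , eq , _) (here refl) = inj₁ (there (here (sym eq)))
  target-closed (_ ∷ es)      (_ , w)      (there e∈) with target-closed es w e∈
  ... | inj₁ t∈ = inj₁ (there t∈)
  ... | inj₂ eq = inj₂ eq

  -- A target is the source of the next transition or the end of the walk, and the end of a closed
  -- walk is its start. Hence the sources are all the vertices of the cycle.
  cycle-target : ∀ {c} → SimpleCycle c → ∀ {e} → e ∈ c → target e ∈ sources c
  cycle-target {c} (s , s∈c , w , _) e∈c with target-closed c w e∈c
  ... | inj₁ t∈   = t∈
  ... | inj₂ refl = s∈c

  -- Simple closed walks as traversals of directed cycles

  module _ (G : Subgraph T) where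
    open Subgraph G

    walk⇒star : ∀ {s t} es → IsWalk s es t → (∀ {e} → e ∈ es → e ∈ₛ edges) →
      Star EdgeIn s t
    walk⇒star []       refl       _  = done
    walk⇒star (e ∷ es) (refl , w) ⊆G =
      (e , ⊆G (here refl) , refl , refl) ◅ walk⇒star es w (⊆G ∘ there)

    star⇒walk : ∀ {s t} → Star EdgeIn s t →
      ∃[ es ] IsWalk s es t × (∀ {e} → e ∈ es → e ∈ₛ edges)
    star⇒walk done = [] , refl , λ ()
    star⇒walk ((e , e∈ , refl , refl) ◅ path) with es , w , ⊆G ← star⇒walk path =
      e ∷ es , (refl , w) , λ { (here refl) → e∈ ; (there x∈) → ⊆G x∈ }

    through : ∀ {s t v} es → IsWalk s es t → (∀ {e} → e ∈ es → e ∈ₛ edges) →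
      v ∈ sources es → Star EdgeIn s v × Star EdgeIn v t
    through (e ∷ es) w          ⊆G (here refl) with refl ← proj₁ w = done , walk⇒star (e ∷ es) w ⊆G
    through (e ∷ es) (refl , w) ⊆G (there v∈)
      with s⟶v , v⟶t ← through es w (⊆G ∘ there) v∈ =
      (e , ⊆G (here refl) , refl , refl) ◅ s⟶v , v⟶t

  simpleCycle⇒directedCycle : ∀ {c} → SimpleCycle c →
    ∃[ C ] (∀ {e} → e ∈ₛ DirectedCycle.edges {T = T} C ⇔ (e ∈ c))
  simpleCycle⇒directedCycle {c} cycle@(s , s∈c , w , c!) = C , ∈-subsetOf c
    where
    V : ∀ {s} → s ∈ₛ subsetOf (sources c) ⇔ (s ∈ sources c)
    V = ∈-subsetOf (sources c)
    K : ∀ {e} → e ∈ₛ subsetOf c ⇔ (e ∈ c)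
    K = ∈-subsetOf c
    G : Subgraph T
    G = record
      { vertices = subsetOf (sources c)
      ; edges    = subsetOf c
      ; source∈  = λ e∈ → from V (∈-map⁺ source (to K e∈))
      ; target∈  = λ e∈ → from V (cycle-target cycle (to K e∈))
      }
    C : DirectedCycle T
    C = record
      { subgraph          = G
      -- From any vertex the closed walk is followed to its base point `s`, and from there to the
      -- other vertex.
      ; stronglyConnected = (s , from V s∈c) , λ u∈ v∈ →
          proj₂ (through G c w (from K) (to V u∈)) ◅◅
          proj₁ (through G c w (from K) (to V v∈))
      ; outDegree1        = λ v∈ →
          let e , e∈c , v≡ = ∈-map⁻ source (to V v∈)
          in e , (from K e∈c , sym v≡) , λ (e′∈ , s≡) →
               Unique-map-injective source c! e∈c (to K e′∈) (trans (sym v≡) (sym s≡))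
      }

  module _ (C : DirectedCycle T) where
    open DirectedCycle C

    out-unique : ∀ {e e′} → e ∈ₛ edges → e′ ∈ₛ edges → source e ≡ source e′ → e ≡ e′
    out-unique e∈ e′∈ eq with _ , _ , unique ← outDegree1 (source∈ e∈) =
      trans (sym (unique (e∈ , refl))) (unique (e′∈ , sym eq))

    -- Out-degree 1 leaves no choice: the edge by which a path leaves a vertex of `c` is the one
    -- that `c` itself uses, so the path never leaves `c`.
    star-closed : ∀ {c} → SimpleCycle c → (∀ {e} → e ∈ c → e ∈ₛ edges) →
      ∀ {s t} → s ∈ sources c → Star EdgeIn s t → t ∈ sources c
    star-closed cycle ⊆C s∈c done = s∈c
    star-closed cycle ⊆C s∈c ((e , e∈ , refl , refl) ◅ path)
      with e′ , e′∈c , s≡ ← ∈-map⁻ source s∈c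
      with refl ← out-unique e∈ (⊆C e′∈c) s≡ =
      star-closed cycle ⊆C (cycle-target cycle e′∈c) path

    -- By strong connectivity the source of any edge of the cycle is reachable from `c`, hence lies
    -- on `c`. The edge of `c` leaving that state must be the given one, by out-degree 1.
    exhausts : ∀ {c} → SimpleCycle c → (∀ {e} → e ∈ c → e ∈ₛ edges) →
      ∀ {e} → e ∈ₛ edges ⇔ (e ∈ c)
    exhausts {c} cycle@(s , s∈c , _) ⊆C {e} = mk⇔ ⊇C ⊆C
      where
      ⊇C : e ∈ₛ edges → e ∈ c
      ⊇C e∈
        with e₀ , e₀∈c , refl ← ∈-map⁻ source s∈c
        with e′ , e′∈c , s≡ ← ∈-map⁻ source
               (star-closed cycle ⊆C s∈c
                 (proj₂ stronglyConnected (source∈ (⊆C e₀∈c)) (source∈ e∈)))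
        with refl ← out-unique e∈ (⊆C e′∈c) s≡ = e′∈c

    -- Some transition `e` of the cycle is closed up by a loop-erased path from its target back to
    -- its source. If that path meets `source e` before its end, it is cut there.
    directedCycle⇒simpleCycle : ∃[ c ] SimpleCycle c × (∀ {e} → e ∈ₛ edges ⇔ (e ∈ c))
    directedCycle⇒simpleCycle
      with (s , s∈) , connected ← stronglyConnected
      with e , (e∈ , refl) , _ ← outDegree1 s∈
      with es , w , ⊆C ← star⇒walk subgraph (connected (target∈ e∈) s∈)
      with es′ , w′ , es′! , es′⊆es , _ ← loopErase es w
      with prepend e es′ w′ es′!
    ... | inj₁ s∉ =
      e ∷ es′ , cycle , exhausts cycle λ { (here refl) → e∈ ; (there x∈) → ⊆C (es′⊆es x∈) }
      where
      cycle : SimpleCycle (e ∷ es′)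
      cycle = source e , here refl , (refl , w′) , All.¬Any⇒All¬ _ s∉ ∷ es′!
    ... | inj₂ (p , q , refl , cycle , _) =
      e ∷ p , cycle , exhausts cycle
        λ { (here refl) → e∈ ; (there x∈) → ⊆C (es′⊆es (∈-++⁺ˡ x∈)) }

    module _ (M : CommutativeMonoid 0ℓ 0ℓ) where
      open CommutativeMonoid M using (Carrier; _≈_; rawMonoid)
      open ListSum M

      -- The monoid is arbitrary because the result serves both the output labels in `ℝ` and the
      -- length in `ℕ`.
      sumOver≈listSum : (g : Transition → Carrier) → ∀ {c} → SimpleCycle c →
        (∀ {e} → e ∈ₛ edges ⇔ (e ∈ c)) → sumOver T rawMonoid g C ≈ listSum g c
      sumOver≈listSum g (_ , _ , _ , c!) edges⇔c =
        sum-indicator g (_∈ₛ? edges) (Unique-map⁻ source c!) edges⇔c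

-- Sums of reals

open ListSum ℝ-+-commutativeMonoid
open CommutativeMonoidSum ℝ-+-commutativeMonoid using (sum)

sum-mono-≤ : ∀ {n} (f g : Fin n → ℝ) (i : ℕ) → (∀ x → seq (f x) i ℚ.≤ seq (g x) i) →
  seq (sum f) i ℚ.≤ seq (sum g) i
sum-mono-≤ {zero}  f g i f≤g = ℚ.≤-refl
sum-mono-≤ {suc n} f g i f≤g =
  ℚ.+-mono-≤ (f≤g zero) (sum-mono-≤ (f ∘ suc) (g ∘ suc) i (f≤g ∘ suc))

module _ {A : Set} (f g : A → ℝ) (∣f∣≤g : ∀ x i → ℚ.∣ seq (f x) i ∣ ℚ.≤ seq (g x) i) where

  ∣listSum∣≤listSum : ∀ xs i → ℚ.∣ seq (listSum f xs) i ∣ ℚ.≤ seq (listSum g xs) i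
  ∣listSum∣≤listSum []       i = ℚ.≤-refl
  ∣listSum∣≤listSum (x ∷ xs) i = ℚ.≤-trans
    (ℚ.∣p+q∣≤∣p∣+∣q∣ (seq (f x) i) (seq (listSum f xs) i))
    (ℚ.+-mono-≤ (∣f∣≤g x i) (∣listSum∣≤listSum xs i))

-- Without repetitions, the sum of `g` along `xs` is a partial sum of `sum g`, and the omitted terms
-- are nonnegative since they dominate absolute values. The bound is thus the same for all such
-- lists.
∣listSum∣≤sum : ∀ {n} (f g : Fin n → ℝ) → (∀ x i → ℚ.∣ seq (f x) i ∣ ℚ.≤ seq (g x) i) →
  {xs : List (Fin n)} → Unique xs → ∣ listSum f xs ∣ᴿ ≤ᴿ sum g
∣listSum∣≤sum f g ∣f∣≤g {xs} xs! =
  ≤ᴿ-trans {∣ listSum f xs ∣ᴿ} {listSum g xs} {sum g}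
    (pointwise⇒≤ᴿ {∣ listSum f xs ∣ᴿ} {listSum g xs} (∣listSum∣≤listSum f g ∣f∣≤g xs))
    (≤ᴿ-trans {listSum g xs} {sum indicated} {sum g}
      (≃⇒≤ᴿ {listSum g xs} {sum indicated} (≃-sym {sum indicated} {listSum g xs}
        (sum-indicator g (_∈? xs) xs! (mk⇔ id id))))
      (pointwise⇒≤ᴿ {sum indicated} {sum g} λ i →
        sum-mono-≤ indicated g i λ x → restrict≤ (does (x ∈? xs)) x i))
  where
  indicated = λ x → if does (x ∈? xs) then g x else 0ᴿ
  restrict≤ : ∀ b x i → seq (if b then g x else 0ᴿ) i ℚ.≤ seq (g x) i
  restrict≤ true  x i = ℚ.≤-refl
  restrict≤ false x i = ℚ.≤-trans (ℚ.0≤∣p∣ (seq (f x) i)) (∣f∣≤g x i)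

listSum-power : {A : Set} (f : A → ℝ) (xs : List A) (m : ℕ) →
  listSum f (concat (replicate m xs)) ≃ m · listSum f xs
listSum-power f xs zero    = ≃-refl {0ᴿ}
listSum-power f xs (suc m) =
  ≃-trans {listSum f (xs ++ loops)} {listSum f xs +ᴿ listSum f loops} {suc m · listSum f xs}
    (listSum-++ f xs)
    (+ᴿ-congˡ (listSum f xs) {listSum f loops} {m · listSum f xs} (listSum-power f xs m))
  where loops = concat (replicate m xs)

seq-listSum-shift : {A : Set} (f g : A → ℝ) (k : ℝ) →
  (∀ x i → seq (f x) i ≡ seq (g x) i ℚ.- seq k i) → (xs : List A) (i : ℕ) →
  seq (listSum f xs) i ≡ seq (listSum g xs) i ℚ.- seq (length xs · k) i
seq-listSum-shift f g k f≡g-k []       i = refl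
seq-listSum-shift f g k f≡g-k (x ∷ xs) i = trans
  (cong₂ ℚ._+_ (f≡g-k x i) (seq-listSum-shift f g k f≡g-k xs i))
  (a-b+[c-d]≡a+c-[b+d] (seq (g x) i) (seq k i) (seq (listSum g xs) i) (seq (length xs · k) i))

-- Output sums as sums along walks

module Excess (T : Transducer) (k : ℝ) where
  open Transducer T
  open Walks T

  weight : Transition → ℝ
  weight e = proj₁ (δ e)

  -- Opaque, because a failed syntactic comparison of reals makes Agda compare
  -- their Cauchy proofs.
  opaque
    excess : Transition → ℝ
    excess e = weight e -ᴿ k

    seq-excess : ∀ e i → seq (excess e) i ≡ seq (weight e) i ℚ.- seq k i
    seq-excess e i = refl

  listSum-excess : ∀ es → listSum excess es ≃ listSum weight es -ᴿ length es · k
  listSum-excess es = ≗⇒≃ (listSum excess es) (listSum weight es -ᴿ length es · k)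
    (seq-listSum-shift excess weight k seq-excess es)

  cycle-excess : (C : DirectedCycle T) → ∀ {c} → SimpleCycle c →
    (∀ {e} → e ∈ₛ DirectedCycle.edges C ⇔ (e ∈ c)) →
    listSum excess c ≃ δ⟨_⟩ T C -ᴿ 𝟙⟨_⟩ T C · k
  cycle-excess C {c} cycle edges⇔c = ≃-shift-resp k
    {listSum excess c} {listSum weight c} {δ⟨_⟩ T C} {length c} {𝟙⟨_⟩ T C}
    (listSum-excess c) (sumOver≈listSum C ℝ-+-commutativeMonoid weight cycle edges⇔c) 𝟙≡length
    where
    listSum-1 : (es : List Transition) →
      ListSum.listSum ℕ.+-0-commutativeMonoid (λ _ → 1) es ≡ length es
    listSum-1 []       = refl
    listSum-1 (_ ∷ es) = cong suc (listSum-1 es)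
    𝟙≡length : 𝟙⟨_⟩ T C ≡ length c
    𝟙≡length = trans (sumOver≈listSum C ℕ.+-0-commutativeMonoid (λ _ → 1) cycle edges⇔c)
      (listSum-1 c)

  Vanishes : Set
  Vanishes = VanishesOnCycles ℝ-+-commutativeMonoid excess

  vanishes⇔ : Vanishes ⇔ (∀ C → δ⟨_⟩ T C ≃ 𝟙⟨_⟩ T C · k)
  vanishes⇔ = mk⇔
    (λ vanish C →
      let c , cycle , edges⇔c = directedCycle⇒simpleCycle C
      in x-y≃0⇒x≃y {δ⟨_⟩ T C} {𝟙⟨_⟩ T C · k}
           (≃-trans {δ⟨_⟩ T C -ᴿ 𝟙⟨_⟩ T C · k} {listSum excess c} {0ᴿ}
             (≃-sym {listSum excess c} {δ⟨_⟩ T C -ᴿ 𝟙⟨_⟩ T C · k} (cycle-excess C cycle edges⇔c))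
             (vanish c cycle)))
    (λ δ≃k𝟙 c cycle →
      let C , edges⇔c = simpleCycle⇒directedCycle cycle
      in ≃-trans {listSum excess c} {δ⟨_⟩ T C -ᴿ 𝟙⟨_⟩ T C · k} {0ᴿ}
           (cycle-excess C cycle edges⇔c)
           (x≃y⇒x-y≃0 {δ⟨_⟩ T C} {𝟙⟨_⟩ T C · k} (δ≃k𝟙 C)))

  -- A run has its last transition outermost, so its walk is read off into an
  -- accumulator.
  walkOf : ∀ {n t} {w : Vec Letter n} → Run T w t → List Transition → List Transition
  walkOf []            es = es
  walkOf (r ▷ (e , _)) es = walkOf r (e ∷ es)

  IsWalk-walkOf : ∀ {n s t} {w : Vec Letter n} (r : Run T w s) es →
    IsWalk s es t → IsWalk initial (walkOf r es) t
  IsWalk-walkOf []               es walk = walk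
  IsWalk-walkOf (r ▷ (e , refl)) es walk = IsWalk-walkOf r (e ∷ es) (refl , walk)

  -- The word `w′` collects the input labels of the transitions, so every walk from the initial
  -- state is realised by some input. Pumping a cycle relies on this.
  extend : ∀ {n s t} {w : Vec Letter n} (r : Run T w s) es → IsWalk s es t →
    ∃₂ λ n′ w′ → ∃[ r′ ] walkOf {n′} {t} {w′} r′ [] ≡ walkOf r es
  extend r []       refl          = _ , _ , r , refl
  extend r (e ∷ es) (refl , walk) = extend (r ▷ (e , refl)) es walk

  accessible-walk : ∀ {s t} → Star (Edge T) s t → ∃[ es ] IsWalk s es t
  accessible-walk done = [] , refl
  accessible-walk ((e , refl , refl) ◅ path) =
    let es , walk = accessible-walk path in e ∷ es , refl , walk

  labelSum : ∀ {n t} {w : Vec Letter n} → Run T w t → ℝ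
  labelSum r = foldr (λ y s → proj₁ y +ᴿ s) 0ᴿ (outputLabels T r)

  -- The accumulator is arbitrary so that the induction can move the last transition of the run into
  -- it, together with its share `k` of `n · k`.
  seq-walkOf : ∀ {n t} {w : Vec Letter n} (r : Run T w t) es i →
    seq (listSum excess (walkOf r es)) i ≡
    (seq (labelSum r) i ℚ.- seq (n · k) i) ℚ.+ seq (listSum excess es) i
  seq-walkOf []                     es i = sym (ℚ.+-identityˡ (seq (listSum excess es) i))
  seq-walkOf {suc n} (r ▷ (e , _)) es i = trans (seq-walkOf r (e ∷ es) i)
    (trans (cong (λ d → L ℚ.- K ℚ.+ (d ℚ.+ X)) (seq-excess e i))
      (L-K+[d-k+X]≡d+L-[k+K]+X L K (seq (weight e) i) (seq k i) X))
    where
    L = seq (labelSum r) i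
    K = seq (n · k) i
    X = seq (listSum excess es) i

  -- Quasi-determinism and vanishing of the excess on cycles

  module _ (subsequential : Subsequential T) (complete : Complete T) where
    open Subsequential subsequential

    final : State → ℝ
    final t = proj₁ (finalOutput t)

    Output-excess : ∀ {n t} {w : Vec Letter n} (r : Run T w t) →
      Output T subsequential complete w -ᴿ n · k ≃ final t +ᴿ listSum excess (walkOf r [])
    Output-excess {n} {t} {w} r
      -- Determinism identifies the given run `r` with the one along which `Output` is computed.
      rewrite run-unique T deterministic (run T complete w) (t , r) =
      ≗⇒≃ ((final t +ᴿ labelSum r) -ᴿ n · k) (final t +ᴿ listSum excess (walkOf r [])) λ i →
        trans
          (a+L-K≡a+[L-K+0] (seq (final t) i) (seq (labelSum r) i) (seq (n · k) i))
          (cong (seq (final t) i ℚ.+_) (sym (seq-walkOf r [] i)))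

    vanishes⇒quasiDeterministic : Vanishes → QuasiDeterministic T subsequential complete k
    vanishes⇒quasiDeterministic vanish = B , bound
      where
      -- The first sum bounds the final output at every state, the second the excess along every
      -- walk without repeated transitions; neither depends on the input.
      B = sum (∣_∣ᴿ ∘ final) +ᴿ sum (∣_∣ᴿ ∘ excess)

      walk-bound : ∀ {t} es → IsWalk initial es t → ∣ final t +ᴿ listSum excess es ∣ᴿ ≤ᴿ B
      walk-bound {t} es walk with es′ , _ , es′! , _ , same ← loopErase es walk =
        ∣∣ᴿ-≤ᴿ-resp-≃ {final t +ᴿ Σes′} {final t +ᴿ Σes} {B}
          (+ᴿ-cong {final t} {final t} {Σes′} {Σes} (≃-refl {final t})
            (≃-sym {Σes} {Σes′} (same ℝ-+-commutativeMonoid excess vanish)))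
          (≤ᴿ-trans {∣ final t +ᴿ Σes′ ∣ᴿ} {∣ Σt ∣ᴿ +ᴿ ∣ Σes′ ∣ᴿ} {B}
            (pointwise⇒≤ᴿ {∣ final t +ᴿ Σes′ ∣ᴿ} {∣ Σt ∣ᴿ +ᴿ ∣ Σes′ ∣ᴿ} λ i →
              subst (λ a → ℚ.∣ seq (final t) i ℚ.+ seq Σes′ i ∣ ℚ.≤ ℚ.∣ a ∣ ℚ.+ ℚ.∣ seq Σes′ i ∣)
                (sym (ℚ.+-identityʳ (seq (final t) i)))
                (ℚ.∣p+q∣≤∣p∣+∣q∣ (seq (final t) i) (seq Σes′ i)))
            (+ᴿ-mono-≤ᴿ {∣ Σt ∣ᴿ} {sum (∣_∣ᴿ ∘ final)} {∣ Σes′ ∣ᴿ} {sum (∣_∣ᴿ ∘ excess)}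
              (∣listSum∣≤sum final (∣_∣ᴿ ∘ final) (λ _ _ → ℚ.≤-refl) ([] ∷ []))
              (∣listSum∣≤sum excess (∣_∣ᴿ ∘ excess) (λ _ _ → ℚ.≤-refl)
                (Unique-map⁻ source es′!))))
        where
        -- Writing the final output as a sum over a one-element list lets `∣listSum∣≤sum` bound it
        -- by the sum over all states; the additional zero is removed at each index above.
        Σt   = listSum final (t ∷ [])
        Σes  = listSum excess es
        Σes′ = listSum excess es′

      bound : ∀ n w → ∣ Output T subsequential complete {n} w -ᴿ n · k ∣ᴿ ≤ᴿ B
      bound n w = ∣∣ᴿ-≤ᴿ-resp-≃ {S} {Out} {B} (≃-sym {Out} {S} (Output-excess r))
        (walk-bound (walkOf r []) (IsWalk-walkOf r [] refl))
        where
        t = proj₁ (run T complete w)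
        r = proj₂ (run T complete w)
        Out = Output T subsequential complete w -ᴿ n · k
        S = final t +ᴿ listSum excess (walkOf r [])

    quasiDeterministic⇒vanishes : Accessible T →
      QuasiDeterministic T subsequential complete k → Vanishes
    quasiDeterministic⇒vanishes accessible (B , bounded) c (s , _ , cycle , _) =
      bounded-multiples⇒≃0 x y B pump
      where
      es : List Transition
      es = proj₁ (accessible-walk (accessible s))
      x y : ℝ
      x = listSum excess c
      -- The part independent of the number of rounds: every round returns to `s`, so the final
      -- output is always that of `s`, after the same access path `es`.
      y = final s +ᴿ listSum excess es
      power-walk : ∀ m → IsWalk s (concat (replicate m c)) s
      power-walk zero    = refl
      power-walk (suc m) = IsWalk-++ c cycle (power-walk m)
      pump : ∀ m → ∣ y +ᴿ m · x ∣ᴿ ≤ᴿ B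
      pump m =
        -- The input follows the access path and then `m` rounds of `c`. Its length grows with `m`,
        -- but `B` is uniform over all lengths and words.
        let n , w , r , walk≡ = extend [] (es ++ concat (replicate m c))
              (IsWalk-++ es (proj₂ (accessible-walk (accessible s))) (power-walk m))
            Out = Output T subsequential complete w -ᴿ n · k
            loops = concat (replicate m c)
        in ∣∣ᴿ-≤ᴿ-resp-≃ {Out} {y +ᴿ m · x} {B}
             (≃-reassoc {Out} {final s} {listSum excess (es ++ loops)} {listSum excess es}
               {listSum excess loops} {m · x}
               (subst (λ es′ → Out ≃ final s +ᴿ listSum excess es′) walk≡ (Output-excess r))
               (listSum-++ excess es) (listSum-power excess c m))
             (bounded n w)

theorem3p3 : (T : Transducer) (subsequential : Subsequential T) (complete : Complete T) →
    WeaklyConnected T → Accessible T →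
    (∃[ k ] QuasiDeterministic T subsequential complete k) ⇔
    (∃[ k ] ((C : DirectedCycle T) → δ⟨_⟩ T C ≃ (𝟙⟨_⟩ T C · k)))
theorem3p3 T subsequential complete _ accessible = mk⇔
  -- Both directions keep the same `k`, since the equivalence holds for each constant separately.
  (λ (k , bounded) → k , to (vanishes⇔ k)
    (quasiDeterministic⇒vanishes k subsequential complete accessible bounded))
  (λ (k , δ≃k𝟙) → k , vanishes⇒quasiDeterministic k subsequential complete
    (from (vanishes⇔ k) δ≃k𝟙))
  where
  open Excess T
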